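{- $1234\sim_{\mathcal I}3214$; that is, for every $n$, the number of involutions in $\mathcal{S}_n$ avoiding $1234$ equals the number of involutions in $\mathcal{S}_n$ avoiding $3214$.
   Context: A permutation $\pi=\pi_1\ldots\pi_n\in\mathcal{S}_n$ avoids $\sigma\in\mathcal{S}_k$ if there is no subsequence $\pi_{i_1}\ldots\pi_{i_k}$, $i_1<\cdots<i_k$, whose order-preserving relabelling by $1,\dots,k$ is $\sigma$. $\mathcal{I}_n(\sigma)$ denotes the number of involutions in $\mathcal{S}_n$ (permutations whose square is the identity) which avoid $\sigma$. Write $\sigma\sim_{\mathcal I}\sigma'$ if $\mathcal{I}_n(\sigma)=\mathcal{I}_n(\sigma')$ for every $n$. -}

module Defs where

open import Algebra.Definitions using (Involutive)
open import Data.Fin.Base using (Fin; _<_; finToFun; funToFin)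
open import Data.Fin.Patterns using (0F; 1F; 2F; 3F)
open import Data.Fin.Permutation
  using (Permutation′; permutation; _⟨$⟩ʳ_; _≈_; _∘ₚ_; id)
open import Data.Fin.Properties using (any?; all?; _≟_; _<?_; finToFun-funToFin)
open import Data.List.Base using (List; allFin; filter; length; map)
open import Data.Nat.Base using (ℕ; _^_)
open import Data.Product.Base using (∃; _×_; _,_)
open import Data.Vec.Base using (Vec; []; _∷_; lookup)
open import Function.Bundles using (_⇔_; mk⇔; Equivalence)
open import Relation.Binary.Definitions using (Monotonic₁)
open import Relation.Binary.PropositionalEquality
  using (_≡_; _≗_; refl; sym; trans; cong; subst₂)
open import Relation.Nullary using (¬_; Dec; yes; no)
open import Relation.Nullary.Decidable
  using (map′; ¬?; _×-dec_; _→-dec_; from-yes)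
open import Relation.Unary using (Decidable)

private
  variable
    k n : ℕ

-- The entries of π at the positions ι 0 < … < ι (k - 1) form a subsequence whose
-- order-preserving relabelling is σ, i.e. the map π (ι a) ↦ σ a preserves and
-- reflects the order.

Occurrence : Permutation′ n → Permutation′ k → (Fin k → Fin n) → Set
Occurrence π σ ι =
  Monotonic₁ _<_ _<_ ι ×
  (∀ a b → (π ⟨$⟩ʳ ι a < π ⟨$⟩ʳ ι b) ⇔ (σ ⟨$⟩ʳ a < σ ⟨$⟩ʳ b))

Contains : Permutation′ n → Permutation′ k → Set
Contains π σ = ∃ λ ι → Occurrence π σ ι

Avoids : Permutation′ n → Permutation′ k → Set
Avoids π σ = ¬ Contains π σ

IsInvolution : Permutation′ n → Set
IsInvolution π = π ∘ₚ π ≈ id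

-- Permutations with the same underlying function need not be propositionally
-- equal, so they are counted through their underlying functions.

IsAvoidingInvolution : Permutation′ k → (Fin n → Fin n) → Set
IsAvoidingInvolution σ f =
  ∃ λ π → (π ⟨$⟩ʳ_) ≗ f × IsInvolution π × Avoids π σ

occurrence? : (π : Permutation′ n) (σ : Permutation′ k) → Decidable (Occurrence π σ)
occurrence? π σ ι =
  map′ (λ mono {a} {b} → mono a b) (λ mono a b → mono {a} {b})
       (all? λ a → all? λ b → (a <? b) →-dec (ι a <? ι b))
  ×-dec
  (all? λ a → all? λ b →
    let p? = π ⟨$⟩ʳ ι a <? π ⟨$⟩ʳ ι b
        q? = σ ⟨$⟩ʳ a <? σ ⟨$⟩ʳ b
    in map′ (λ (to , from) → mk⇔ to from)
            (λ eq → Equivalence.to eq , Equivalence.from eq)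
            ((p? →-dec q?) ×-dec (q? →-dec p?)))

occurrence-resp : (π π′ : Permutation′ n) (σ : Permutation′ k) {ι ι′ : Fin k → Fin n} →
                  π ≈ π′ → ι ≗ ι′ → Occurrence π σ ι → Occurrence π′ σ ι′
occurrence-resp π π′ σ {ι} {ι′} π≈π′ ι≗ι′ (mono , order) =
  (λ {a} {b} a<b → subst₂ _<_ (ι≗ι′ a) (ι≗ι′ b) (mono a<b)) ,
  (λ a b → mk⇔
    (λ lt → Equivalence.to (order a b) (subst₂ _<_ (sym (eq a)) (sym (eq b)) lt))
    (λ lt → subst₂ _<_ (eq a) (eq b) (Equivalence.from (order a b) lt)))
  where
  eq : ∀ a → π ⟨$⟩ʳ ι a ≡ π′ ⟨$⟩ʳ ι′ a
  eq a = trans (cong (π ⟨$⟩ʳ_) (ι≗ι′ a)) (π≈π′ (ι′ a))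

contains? : (π : Permutation′ n) (σ : Permutation′ k) → Dec (Contains π σ)
contains? π σ =
  map′ (λ (c , occ) → finToFun c , occ)
       (λ (ι , occ) → funToFin ι ,
         occurrence-resp π π σ (λ _ → refl) (λ a → sym (finToFun-funToFin ι a)) occ)
       (any? λ c → occurrence? π σ (finToFun c))

avoids? : (π : Permutation′ n) (σ : Permutation′ k) → Dec (Avoids π σ)
avoids? π σ = ¬? (contains? π σ)

fromInvolutive : (f : Fin n → Fin n) → Involutive _≡_ f → Permutation′ n
fromInvolutive f inv = permutation f f inv inv

isAvoidingInvolution? : (σ : Permutation′ k) →
                        Decidable (IsAvoidingInvolution {n = n} σ)
isAvoidingInvolution? σ f with all? (λ i → f (f i) ≟ i)
... | no ¬inv = no λ (π , π≗f , inv , _) → ¬inv λ i →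
  trans (sym (trans (cong (π ⟨$⟩ʳ_) (π≗f i)) (π≗f (f i)))) (inv i)
... | yes inv =
  map′ (λ av → fromInvolutive f inv , (λ _ → refl) , inv , av)
       (λ (π , π≗f , _ , av) (ι , occ) → av
         (ι , occurrence-resp (fromInvolutive f inv) π σ
                (λ i → sym (π≗f i)) (λ _ → refl) occ))
       (avoids? (fromInvolutive f inv) σ)

-- finToFun is a bijection from Fin (n ^ n) onto the functions Fin n → Fin n (up to
-- pointwise equality), so every function is listed exactly once.

selfMaps : ∀ n → List (Fin n → Fin n)
selfMaps n = map finToFun (allFin (n ^ n))

ℐ : (n : ℕ) → Permutation′ k → ℕ
ℐ n σ = length (filter (isAvoidingInvolution? σ) (selfMaps n))

infix 4 _∼ℐ_

_∼ℐ_ : ∀ {k k′} → Permutation′ k → Permutation′ k′ → Set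
σ ∼ℐ σ′ = ∀ n → ℐ n σ ≡ ℐ n σ′

-- The words below are zero-based: the letter i is written as the element i - 1 of Fin 4.

word1234 : Vec (Fin 4) 4
word1234 = 0F ∷ 1F ∷ 2F ∷ 3F ∷ []

word3214 : Vec (Fin 4) 4
word3214 = 2F ∷ 1F ∷ 0F ∷ 3F ∷ []

-- Both patterns are their own inverses.

p1234 : Permutation′ 4
p1234 = fromInvolutive (lookup word1234)
  (from-yes (all? λ i → lookup word1234 (lookup word1234 i) ≟ i))

p3214 : Permutation′ 4
p3214 = fromInvolutive (lookup word3214)
  (from-yes (all? λ i → lookup word3214 (lookup word3214 i) ≟ i))

{-# OPTIONS --safe #-}
module Submission where

open import Defs

open import Algebra.Definitions using (Involutive)
open import Data.Bool.Base using (Bool; true; false; if_then_else_)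
import Data.Bool.Properties as Bool
open import Data.Fin.Base as Fin using (Fin; toℕ; fromℕ<; funToFin)
open import Data.Fin.Patterns using (0F; 1F; 2F; 3F)
open import Data.Fin.Permutation using (Permutation′; _⟨$⟩ʳ_; inverseʳ)
import Data.Fin.Properties as Fin
open import Data.Fin.Properties
  using (any?; toℕ<n; toℕ-injective; toℕ-fromℕ<; funToFin-finToFin; finToFun-funToFin)
import Data.List.Base as List
open import Data.List.Membership.Propositional.Properties using (∈-lookup; ∈-allFin)
open import Data.List.Membership.Setoid.Properties using (∈-filter⁺; index-injective)
import Data.List.Relation.Unary.All as All
open import Data.List.Relation.Unary.All.Properties using (all-filter)
open import Data.List.Relation.Unary.AllPairs using (_∷_)
open import Data.List.Relation.Unary.Any as Any using (Any)
import Data.List.Relation.Unary.Any.Properties as Any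
open import Data.List.Relation.Unary.Unique.Propositional.Properties using (allFin⁺)
open import Data.List.Relation.Unary.Unique.Setoid using (Unique)
import Data.List.Relation.Unary.Unique.Setoid.Properties as Unique
open import Data.Nat.Base
  using (ℕ; zero; suc; _+_; _^_; _≤_; _<_; _⊔_; z≤n; s≤s; z<s; s≤s⁻¹)
open import Data.Nat.Properties
open import Data.Nat.Tactic.RingSolver using (solve-∀)
open import Data.Product.Base using (Σ; ∃; ∃₂; _×_; _,_; proj₁; proj₂)
open import Data.Sum.Base using (_⊎_; inj₁; inj₂)
open import Data.Vec.Base using (lookup; _∷_; [])
open import Function.Base using (_∘_; case_of_)
open import Function.Bundles using (mk⇔; Equivalence)
open import Relation.Binary.Bundles using (Setoid)
open import Relation.Binary.Definitions
  using (Monotonic₁; _Respects_; tri<; tri≈; tri>)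
open import Relation.Binary.PropositionalEquality
  using (_≡_; _≢_; _≗_; refl; sym; trans; cong; cong₂; subst; subst₂; setoid; _→-setoid_)
open import Relation.Nullary using (¬_; Dec; yes; no; does; contradiction)
open import Relation.Nullary.Decidable using (map′; _×-dec_; dec-true)
open import Relation.Unary using (Pred; Decidable)

-- An involution avoids τ4, for τ = 123 or 321, iff every dot of its permutation matrix has no
-- τ in the rectangle strictly below and to the left of it. Fomin's growth rule attaches a
-- partition to each corner of these cells; τ is avoided iff the partitions have at most two
-- columns (τ = 123) or two rows (τ = 321), and the dots can be recovered from the partitions
-- on the border of the region. Keeping the conjugated partitions on the border, as well as
-- the dots outside the region, and recomputing the inside with the other rule exchanges
-- 123 and 321. The rules are symmetric in rows and columns, so symmetric matrices stay
-- symmetric, and the size of a partition counts dots, so row sums are preserved.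

-- (b , h) stands for the partition (b + h , b), so that no inequality has to be carried along.

-- Forwards a rule is partial, and its failure is what signals a triple. Backwards it is total and
-- deterministic: any two edges into a common upper right shape come from exactly one cell. As
-- `Shape` encodes two rows and two columns alike, a border produced by one rule can always be
-- refilled by the other. That the refilled matrix is again an involution is not visible in the
-- cells. Symmetry follows from uniqueness of the refilling, and the row sums are read off from
-- shapes on the unchanged border. The region itself survives because a dot with no other dot
-- strictly above and to the right of it lies outside and is kept. Determinism makes the passage
-- injective, and exchanging the rules gives an injection the other way, so the counts bound each
-- other. The obstacle is to tie failure to triples. The column rule fails at the last dot of an
-- increasing triple, but the row rule fails at a cell without a dot, where local information is not
-- enough; there Schensted's theorem on the first row supplies the missing link.

Shape : Set
Shape = ℕ × ℕ

pattern ∅ = (0 , 0)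

size : Shape → ℕ
size (b , h) = b + b + h

data Step : Shape → Shape → Set where
  one : ∀ {b h} → Step (b , h) (b , suc h)
  two : ∀ {b h} → Step (b , suc h) (suc b , h)

data Edge : Shape → Shape → Set where
  none : ∀ {α} → Edge α α
  step : ∀ {α β} → Step α β → Edge α β

step-size : ∀ {α β} → Step α β → size β ≡ suc (size α)
step-size (one {b} {h}) = +-suc (b + b) h
step-size (two {b} {h}) = lemma b h
  where
  lemma : ∀ b h → suc b + suc b + h ≡ suc (b + b + suc h)
  lemma = solve-∀

step-irrefl : ∀ {α} → ¬ Step α α
step-irrefl st = 1+n≢n (sym (step-size st))

edge-from-∅ : ∀ {α} → Edge α ∅ → α ≡ ∅
edge-from-∅ none = refl

bit : Bool → ℕ
bit d = if d then 1 else 0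

-- A cell of a growth diagram has the shapes α, β, γ, δ at its lower left, upper left,
-- lower right and upper right corner, and d tells whether it holds a dot. Only the cells
-- with β = γ ≠ δ depend on the insertion rule.

record Rule : Set₁ where
  field
    Corner        : (α β δ : Shape) → Bool → Set
    cornerOut     : ∀ {α β δ d} → Corner α β δ d → Step β δ
    cornerIn      : ∀ {α β δ d} → Corner α β δ d →
                    (d ≡ true × α ≡ β) ⊎ (d ≡ false × Step α β)
    corner-back   : ∀ {β δ} → Step β δ → ∃₂ λ α d → Corner α β δ d
    corner-back-unique : ∀ {α α′ β δ d d′} → Corner α β δ d → Corner α′ β δ d′ →
                         α ≡ α′ × d ≡ d′
    corner-unique : ∀ {α β δ δ′ d} → Corner α β δ d → Corner α β δ′ d → δ ≡ δ′

open Rule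

data Cell (R : Rule) : (α β γ δ : Shape) → Bool → Set where
  flatˡ  : ∀ {α γ} → Edge α γ → Cell R α α γ γ false
  flatʳ  : ∀ {α β} → Edge α β → Cell R α β α β false
  cross  : ∀ {b h} → Cell R (b , suc h) (b , suc (suc h)) (suc b , h) (suc b , suc h) false
  cross′ : ∀ {b h} → Cell R (b , suc h) (suc b , h) (b , suc (suc h)) (suc b , suc h) false
  corner : ∀ {α β δ d} → Corner R α β δ d → Cell R α β β δ d

-- One cell: symmetry, edges, size and reversibility.

module _ {R : Rule} where

  cell-sym : ∀ {α β γ δ d} → Cell R α β γ δ d → Cell R α γ β δ d
  cell-sym (flatˡ e)  = flatʳ e
  cell-sym (flatʳ e)  = flatˡ e
  cell-sym cross      = cross′
  cell-sym cross′     = cross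
  cell-sym (corner c) = corner c

  left-edge : ∀ {α β γ δ d} → Cell R α β γ δ d → Edge α β
  left-edge (flatˡ e)  = none
  left-edge (flatʳ e)  = e
  left-edge cross      = step one
  left-edge cross′     = step two
  left-edge (corner c) with cornerIn R c
  ... | inj₁ (refl , refl) = none
  ... | inj₂ (refl , st)   = step st

  right-edge : ∀ {α β γ δ d} → Cell R α β γ δ d → Edge γ δ
  right-edge (flatˡ e)  = none
  right-edge (flatʳ e)  = e
  right-edge cross      = step one
  right-edge cross′     = step two
  right-edge (corner c) = step (cornerOut R c)

  -- The mixed second difference of the size over a cell is its number of dots. `count` obeys the
  -- same recursion (`count-cell`), which is how sizes come to count dots.
  cell-size : ∀ {α β γ δ d} → Cell R α β γ δ d →
              size δ + size α ≡ size β + size γ + bit d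
  cell-size {α} (flatˡ {γ = γ} _) =
    trans (+-comm (size γ) (size α)) (sym (+-identityʳ _))
  cell-size (flatʳ _) = sym (+-identityʳ _)
  cell-size (cross {b} {h}) = lemma b h
    where
    lemma : ∀ b h → (suc b + suc b + suc h) + (b + b + suc h)
                  ≡ (b + b + suc (suc h)) + (suc b + suc b + h) + 0
    lemma = solve-∀
  cell-size (cross′ {b} {h}) = lemma b h
    where
    lemma : ∀ b h → (suc b + suc b + suc h) + (b + b + suc h)
                  ≡ (suc b + suc b + h) + (b + b + suc (suc h)) + 0
    lemma = solve-∀
  cell-size (corner {α} {β} c) with cornerIn R c
  ... | inj₁ (refl , refl) rewrite step-size (cornerOut R c) = lemma (size β)
    where
    lemma : ∀ m → suc m + m ≡ m + m + 1
    lemma = solve-∀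
  ... | inj₂ (refl , st) rewrite step-size (cornerOut R c) | step-size st = lemma (size α)
    where
    lemma : ∀ m → suc (suc m) + m ≡ suc m + suc m + 0
    lemma = solve-∀

  -- Removing boxes never leaves the two-row or two-column shapes, so no case is missing here,
  -- whereas the forward direction lacks corners.
  cell-back : ∀ {β γ δ} → Edge β δ → Edge γ δ → ∃₂ λ α d → Cell R α β γ δ d
  cell-back none       e          = _ , _ , flatʳ e
  cell-back e          none       = _ , _ , flatˡ e
  cell-back (step one) (step one) with α , d , c ← corner-back R one = α , d , corner c
  cell-back (step two) (step two) with α , d , c ← corner-back R two = α , d , corner c
  cell-back (step one) (step two) = _ , _ , cross′
  cell-back (step two) (step one) = _ , _ , cross

  cell-unique : ∀ {α β γ δ δ′ d} → Cell R α β γ δ d → Cell R α β γ δ′ d → δ ≡ δ′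
  cell-unique (flatˡ _)  (flatˡ _)  = refl
  cell-unique (flatˡ _)  (flatʳ _)  = refl
  cell-unique (flatʳ _)  (flatˡ _)  = refl
  cell-unique (flatʳ _)  (flatʳ _)  = refl
  cell-unique cross      cross      = refl
  cell-unique cross′     cross′     = refl
  cell-unique (corner c) (corner c′) = corner-unique R c c′
  cell-unique (flatˡ _)  (corner c) with cornerIn R c
  ... | inj₂ (_ , st) = contradiction st step-irrefl
  cell-unique (flatʳ _)  (corner c) with cornerIn R c
  ... | inj₂ (_ , st) = contradiction st step-irrefl
  cell-unique (corner c) (flatˡ _) with cornerIn R c
  ... | inj₂ (_ , st) = contradiction st step-irrefl
  cell-unique (corner c) (flatʳ _) with cornerIn R c
  ... | inj₂ (_ , st) = contradiction st step-irrefl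

  cell-back-unique : ∀ {α α′ β γ δ d d′} → Cell R α β γ δ d → Cell R α′ β γ δ d′ →
                     α ≡ α′ × d ≡ d′
  cell-back-unique (flatˡ _)  (flatˡ _)  = refl , refl
  cell-back-unique (flatˡ _)  (flatʳ _)  = refl , refl
  cell-back-unique (flatʳ _)  (flatˡ _)  = refl , refl
  cell-back-unique (flatʳ _)  (flatʳ _)  = refl , refl
  cell-back-unique cross      cross      = refl , refl
  cell-back-unique cross′     cross′     = refl , refl
  cell-back-unique (corner c) (corner c′) = corner-back-unique R c c′
  cell-back-unique (flatˡ _)  (corner c) = contradiction (cornerOut R c) step-irrefl
  cell-back-unique (flatʳ _)  (corner c) = contradiction (cornerOut R c) step-irrefl
  cell-back-unique (corner c) (flatˡ _)  = contradiction (cornerOut R c) step-irrefl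
  cell-back-unique (corner c) (flatʳ _)  = contradiction (cornerOut R c) step-irrefl

-- Row insertion. There is no corner with β obtained from α by a box in the second row: it
-- would need a third row, and this happens exactly when there is a decreasing triple of dots.

data RowCorner : (α β δ : Shape) → Bool → Set where
  insert : ∀ {b h} → RowCorner (b , h) (b , h) (b , suc h) true
  bump   : ∀ {b h} → RowCorner (b , h) (b , suc h) (suc b , h) false

rowRule : Rule
rowRule = record
  { Corner             = RowCorner
  ; cornerOut          = λ { insert → one ; bump → two }
  ; cornerIn           = λ { insert → inj₁ (refl , refl) ; bump → inj₂ (refl , one) }
  ; corner-back        = λ { one → _ , _ , insert ; two → _ , _ , bump }
  ; corner-back-unique = λ { insert insert → refl , refl ; bump bump → refl , refl }
  ; corner-unique      = λ { insert insert → refl ; bump bump → refl }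
  }

-- The same insertion with partitions conjugated: b and b + h are now column lengths. A dot
-- on top of b > 0 would need a third column, i.e. an increasing triple of dots.

data ColumnCorner : (α β δ : Shape) → Bool → Set where
  insert₁ : ColumnCorner (0 , 0) (0 , 0) (0 , 1) true
  insert₂ : ∀ {h} → ColumnCorner (0 , suc h) (0 , suc h) (1 , h) true
  bump₁   : ∀ {b h} → ColumnCorner (b , h) (b , suc h) (b , suc (suc h)) false
  bump₂   : ∀ {b h} → ColumnCorner (b , suc (suc h)) (suc b , suc h) (suc (suc b) , h) false
  -- A bump sends the box to the next row. Here both columns of the middle shape have length
  -- `b + 1`, so row `b + 2` is empty and its box starts in the first column.
  wrap    : ∀ {b} → ColumnCorner (b , 1) (suc b , 0) (suc b , 1) false

columnRule : Rule
columnRule = record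
  { Corner             = ColumnCorner
  ; cornerOut          = λ
    { insert₁ → one ; insert₂ → two ; bump₁ → one ; bump₂ → two ; wrap → one }
  ; cornerIn           = λ
    { insert₁ → inj₁ (refl , refl) ; insert₂ → inj₁ (refl , refl) ; bump₁ → inj₂ (refl , one)
    ; bump₂ → inj₂ (refl , two) ; wrap → inj₂ (refl , two) }
  ; corner-back        = λ
    { (one {zero} {zero})  → _ , _ , insert₁
    ; (one {suc b} {zero}) → _ , _ , wrap
    ; (one {b} {suc h})    → _ , _ , bump₁
    ; (two {zero} {h})     → _ , _ , insert₂
    ; (two {suc b} {h})    → _ , _ , bump₂ }
  ; corner-back-unique = λ
    { insert₁ insert₁ → refl , refl ; insert₂ insert₂ → refl , refl ; bump₁ bump₁ → refl , refl
    ; bump₂ bump₂ → refl , refl ; wrap wrap → refl , refl }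
  ; corner-unique      = λ
    { insert₁ insert₁ → refl ; insert₂ insert₂ → refl ; bump₁ bump₁ → refl
    ; bump₂ bump₂ → refl ; wrap wrap → refl }
  }

-- Dot counts and growth diagrams.

Diagram : Set
Diagram = ℕ → ℕ → Bool

Dot : Diagram → ℕ → ℕ → Set
Dot D i j = D i j ≡ true

row : Diagram → ℕ → ℕ → ℕ
row D i zero    = 0
row D i (suc j) = row D i j + bit (D i j)

count : Diagram → ℕ → ℕ → ℕ
count D zero    j = 0
count D (suc i) j = count D i j + row D i j

count-zero : ∀ D i → count D i 0 ≡ 0
count-zero D zero    = refl
count-zero D (suc i) = trans (+-identityʳ _) (count-zero D i)

count-cell : ∀ D i j → count D (suc i) (suc j) + count D i j
                     ≡ count D (suc i) j + count D i (suc j) + bit (D i j)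
count-cell D i j = lemma (count D i (suc j)) (row D i j) (bit (D i j)) (count D i j)
  where
  lemma : ∀ x y z w → x + (y + z) + w ≡ w + y + x + z
  lemma = solve-∀

row-dot : ∀ {D i j c} → c < j → Dot D i c → 0 < row D i j
row-dot {D} {i} {suc j} {c} c<1+j dot with m≤n⇒m<n∨m≡n (s≤s⁻¹ c<1+j)
... | inj₁ c<j  = ≤-trans (row-dot c<j dot) (m≤m+n _ _)
... | inj₂ refl rewrite dot = m≤n+m 1 _

row-find : ∀ D i j → 0 < row D i j → ∃ λ c → c < j × Dot D i c
row-find D i (suc j) pos with D i j in eq
... | true  = j , ≤-refl , eq
... | false with c , c<j , dot ← row-find D i j (subst (0 <_) (+-identityʳ _) pos)
            = c , m≤n⇒m≤1+n c<j , dot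

-- Grow R D i j α: under rule R the shape at (i , j), the upper right corner of the
-- rectangle of cells (r , c) with r < i and c < j, is α.

data Grow (R : Rule) (D : Diagram) : ℕ → ℕ → Shape → Set where
  axisˡ : ∀ {i} → Grow R D i 0 ∅
  axisʳ : ∀ {j} → Grow R D 0 j ∅
  cell  : ∀ {i j α β γ δ d} → Grow R D i j α → Grow R D (suc i) j β → Grow R D i (suc j) γ →
          D i j ≡ d → Cell R α β γ δ d → Grow R D (suc i) (suc j) δ

module _ {R : Rule} {D : Diagram} where

  grow-unique : ∀ {i j α α′} → Grow R D i j α → Grow R D i j α′ → α ≡ α′
  grow-unique axisˡ axisˡ = refl
  grow-unique axisˡ axisʳ = refl
  grow-unique axisʳ axisˡ = refl
  grow-unique axisʳ axisʳ = refl
  grow-unique (cell a b c refl k) (cell a′ b′ c′ refl k′)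
    with refl ← grow-unique a a′ | refl ← grow-unique b b′ | refl ← grow-unique c c′
    = cell-unique k k′

  grow-edge : ∀ {i j α β} → Grow R D i j α → Grow R D (suc i) j β → Edge α β
  grow-edge axisˡ axisˡ = none
  grow-edge axisʳ axisˡ = none
  grow-edge g (cell _ _ g′ _ k) with refl ← grow-unique g g′ = right-edge k

  grow-size : ∀ {i j α} → Grow R D i j α → size α ≡ count D i j
  grow-size {i} axisˡ = sym (count-zero D i)
  grow-size axisʳ = refl
  grow-size (cell {i} {j} {α} {β} {γ} {δ} a b c refl k) = +-cancelʳ-≡ (size α) _ _
    (trans (cell-size k) (trans
      (cong₂ (λ x y → x + y + bit (D i j)) (grow-size b) (grow-size c))
      (trans (sym (count-cell D i j)) (cong (count D (suc i) (suc j) +_) (sym (grow-size a))))))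

  grow-sym : (∀ i j → D i j ≡ D j i) → ∀ {i j α} → Grow R D i j α → Grow R D j i α
  grow-sym D-sym axisˡ = axisʳ
  grow-sym D-sym axisʳ = axisˡ
  grow-sym D-sym (cell a b c refl k) =
    cell (grow-sym D-sym a) (grow-sym D-sym c) (grow-sym D-sym b) (D-sym _ _) (cell-sym k)

  -- Sizes of vertically adjacent shapes differ by the dots of the row segment between the axis and
  -- them; thus an edge tells whether that segment holds a dot.
  row-flat : ∀ {i j α} → Grow R D i j α → Grow R D (suc i) j α → row D i j ≡ 0
  row-flat {i} {j} g g′ = m+n≡m⇒n≡0 (count D i j) (trans (sym (grow-size g′)) (grow-size g))
    where
    m+n≡m⇒n≡0 : ∀ m {n} → m + n ≡ m → n ≡ 0
    m+n≡m⇒n≡0 m eq = +-cancelˡ-≡ m _ _ (trans eq (sym (+-identityʳ m)))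

  row-step : ∀ {i j α β} → Grow R D i j α → Grow R D (suc i) j β → Step α β → row D i j ≡ 1
  row-step {i} {j} {α} g g′ st = +-cancelˡ-≡ (count D i j) _ _
    (trans (sym (grow-size g′)) (trans (step-size st)
      (trans (cong suc (grow-size g)) (+-comm 1 _))))

  step-dot : ∀ {i j α β} → Grow R D i j α → Grow R D (suc i) j β → Step α β →
             ∃ λ c → c < j × Dot D i c
  step-dot {i} {j} g g′ st = row-find D i j (subst (0 <_) (sym (row-step g g′ st)) z<s)

  dot-step : ∀ {i j c α β} → Grow R D i j α → Grow R D (suc i) j β → c < j → Dot D i c →
             Step α β
  dot-step {D} g g′ c<j dot with grow-edge g g′
  ... | step st = st
  ... | none    = contradiction (subst (0 <_) (row-flat g g′) (row-dot c<j dot)) n≮0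

-- Matrices of involutions and the region below their dots.

record InvolutionDiagram (n : ℕ) (D : Diagram) : Set where
  field
    symmetric : ∀ i j → D i j ≡ D j i
    unique    : ∀ {i j k} → Dot D i j → Dot D i k → j ≡ k
    bounded   : ∀ {i j} → Dot D i j → i < n
    total     : ∀ {i} → i < n → ∃ λ j → Dot D i j

  flip-dot : ∀ {i j} → Dot D i j → Dot D j i
  flip-dot dot = trans (symmetric _ _) dot

-- The cell (i , j) has a dot strictly above and to the right of it iff Below D (suc i) (suc j).

Below : Diagram → ℕ → ℕ → Set
Below D i j = ∃₂ λ k l → i ≤ k × j ≤ l × Dot D k l

below-mono : ∀ {D i i′ j j′} → i ≤ i′ → j ≤ j′ → Below D i′ j′ → Below D i j
below-mono i≤ j≤ (k , l , i′≤k , j′≤l , dot) =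
  k , l , ≤-trans i≤ i′≤k , ≤-trans j≤ j′≤l , dot

-- D′ arises from D by keeping the shapes along the border of the region below the dots and
-- recomputing its cells with R′ instead of R. The relation is symmetric in (R , D) and (R′ , D′).

record Transfer (R R′ : Rule) (D D′ : Diagram) : Set where
  field
    below   : ∀ {i j} → Below D i j → Below D′ i j
    below′  : ∀ {i j} → Below D′ i j → Below D i j
    outside : ∀ {i j} → ¬ Below D (suc i) (suc j) → D i j ≡ D′ i j
    border  : ∀ {i j} → Below D i j → ¬ Below D (suc i) (suc j) →
              ∃ λ α → Grow R D i j α × Grow R′ D′ i j α
    grow    : ∀ {i j} → Below D i j → ∃ λ α → Grow R D i j α
    grow′   : ∀ {i j} → Below D i j → ∃ λ α → Grow R′ D′ i j α

module _ {n : ℕ} {D : Diagram} (I : InvolutionDiagram n D) where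
  open InvolutionDiagram I

  below-sym : ∀ {i j} → Below D i j → Below D j i
  below-sym (k , l , i≤k , j≤l , dot) = l , k , j≤l , i≤k , flip-dot dot

  below-row : ∀ {i j} → Below D i j → i < n
  below-row (k , l , i≤k , j≤l , dot) = ≤-<-trans i≤k (bounded dot)

  below-col : ∀ {i j} → Below D i j → j < n
  below-col b = below-row (below-sym b)

  below? : ∀ i j → Dec (Below D i j)
  below? i j = map′
    (λ { (k , _ , l , _ , i≤k , j≤l , dot) → k , l , i≤k , j≤l , dot })
    (λ { (k , l , i≤k , j≤l , dot) →
         k , bounded dot , l , bounded (flip-dot dot) , i≤k , j≤l , dot })
    (anyUpTo? (λ k → anyUpTo? (λ l → (i ≤? k) ×-dec (j ≤? l) ×-dec (D k l Bool.≟ true)) n) n)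

  row≡1 : ∀ {i} → i < n → row D i n ≡ 1
  row≡1 {i} i<n with c , dot ← total i<n = go n (bounded (flip-dot dot))
    where
    empty : ∀ j → j ≤ c → row D i j ≡ 0
    empty zero    _   = refl
    empty (suc j) j<c with D i j in eq
    ... | true  = contradiction (unique eq dot) (<⇒≢ j<c)
    ... | false = trans (+-identityʳ _) (empty j (<⇒≤ j<c))
    go : ∀ j → c < j → row D i j ≡ 1
    go (suc j) c<1+j with m≤n⇒m<n∨m≡n (s≤s⁻¹ c<1+j)
    ... | inj₂ refl rewrite dot | empty c ≤-refl = refl
    ... | inj₁ c<j with D i j in eq
    ... | true  = contradiction (unique dot eq) (<⇒≢ c<j)
    ... | false = trans (+-identityʳ _) (go j c<j)

row-unique : ∀ {D i j k l} → row D i j ≡ 1 → k < j → l < j → Dot D i k → Dot D i l → k ≡ l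
row-unique {D} {i} {suc j} {k} {l} eq k<1+j l<1+j dotₖ dotₗ
  with m≤n⇒m<n∨m≡n (s≤s⁻¹ k<1+j) | m≤n⇒m<n∨m≡n (s≤s⁻¹ l<1+j)
... | inj₂ refl | inj₂ refl = refl
... | inj₁ k<j  | inj₂ refl rewrite dotₗ =
      contradiction (subst (0 <_) (+-cancelʳ-≡ 1 _ 0 eq) (row-dot k<j dotₖ)) n≮0
... | inj₂ refl | inj₁ l<j  rewrite dotₖ =
      contradiction (subst (0 <_) (+-cancelʳ-≡ 1 _ 0 eq) (row-dot l<j dotₗ)) n≮0
... | inj₁ k<j  | inj₁ l<j with D i j
...   | true  = contradiction (subst (0 <_) (+-cancelʳ-≡ 1 _ 0 eq) (row-dot k<j dotₖ)) n≮0
...   | false = row-unique (trans (sym (+-identityʳ _)) eq) k<j l<j dotₖ dotₗ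

-- Refilling the region with the other rule.

module Construct {n : ℕ} {D : Diagram} (I : InvolutionDiagram n D) (R R′ : Rule)
  (grow : ∀ {i j} → Below D i j → ∃ λ α → Grow R D i j α) where

  open InvolutionDiagram I

  -- Back i j α: α is the shape at (i , j) that rule R′ recovers from the border.
  data Back : ℕ → ℕ → Shape → Set where
    border : ∀ {i j α} → Below D i j → ¬ Below D (suc i) (suc j) → Grow R D i j α → Back i j α
    inner  : ∀ {i j α β γ δ d} → Below D (suc i) (suc j) →
             Back (suc i) j β → Back i (suc j) γ → Back (suc i) (suc j) δ →
             Cell R′ α β γ δ d → Back i j α

  back-below : ∀ {i j α} → Back i j α → Below D i j
  back-below (border b _ _)    = b
  back-below (inner b _ _ _ _) = below-mono (n≤1+n _) (n≤1+n _) b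

  back-unique : ∀ {i j α α′} → Back i j α → Back i j α′ → α ≡ α′
  back-unique (border _ _ g)    (border _ _ g′)   = grow-unique g g′
  back-unique (border _ ¬b _)   (inner b _ _ _ _) = contradiction b ¬b
  back-unique (inner b _ _ _ _) (border _ ¬b _)   = contradiction b ¬b
  back-unique (inner _ β γ δ k) (inner _ β′ γ′ δ′ k′)
    with refl ← back-unique β β′ | refl ← back-unique γ γ′ | refl ← back-unique δ δ′
    = proj₁ (cell-back-unique k k′)

  back-sym : ∀ {i j α} → Back i j α → Back j i α
  back-sym (border b ¬b g) =
    border (below-sym I b) (λ b′ → ¬b (below-sym I b′)) (grow-sym symmetric g)
  back-sym (inner b β γ δ k) =
    inner (below-sym I b) (back-sym γ) (back-sym β) (back-sym δ) (cell-sym k)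

  back-edge : ∀ {i j α β} → Back i j α → Back (suc i) j β → Edge α β
  back-edge (inner _ β _ _ k) β′ with refl ← back-unique β β′ = left-edge k
  back-edge (border _ ¬b g) (border _ _ g′) = grow-edge g g′
  back-edge (border _ ¬b g) (inner b _ _ _ _) =
    contradiction (below-mono (n≤1+n _) ≤-refl b) ¬b

  -- The recursion runs up and to the right. Both coordinates stay below `n` inside the region, so
  -- `n + n` bounds `i + j` and the fuel cannot run out.
  back-exists : ∀ fuel {i j} → n + n ≤ fuel + (i + j) → Below D i j → ∃ λ α → Back i j α
  back-exists zero le b =
    contradiction (<-≤-trans (+-mono-< (below-row I b) (below-col I b)) le) (<-irrefl refl)
  back-exists (suc fuel) {i} {j} le b with below? I (suc i) (suc j)
  ... | no ¬b′ = _ , border b ¬b′ (proj₂ (grow b))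
  ... | yes b′ = _ , inner b′ β γ δ (proj₂ (proj₂ (cell-back
      (back-edge (back-sym β) (back-sym δ)) (back-edge γ δ))))
    where
    le₁ : n + n ≤ fuel + suc (i + j)
    le₁ = subst (n + n ≤_) (sym (+-suc fuel (i + j))) le
    le₂ : n + n ≤ fuel + (i + suc j)
    le₂ = subst (λ m → n + n ≤ fuel + m) (sym (+-suc i j)) le₁
    β = proj₂ (back-exists fuel le₁ (below-mono ≤-refl (n≤1+n _) b′))
    γ = proj₂ (back-exists fuel le₂ (below-mono (n≤1+n _) ≤-refl b′))
    δ = proj₂ (back-exists fuel (≤-trans le₂ (+-monoʳ-≤ fuel (n≤1+n _))) b′)

  back : ∀ {i j} → Below D i j → ∃ λ α → Back i j α
  back = back-exists (n + n) (m≤m+n _ _)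

  -- The boundary condition of `Grow` is recovered and not imposed: the border meets the axis in
  -- `∅`, and an edge into `∅` starts in `∅`.
  back-axis : ∀ {i α} → Back i 0 α → α ≡ ∅
  back-axis (border _ _ g) = grow-unique g axisˡ
  back-axis (inner _ β _ _ k) with refl ← back-axis β = edge-from-∅ (left-edge k)

  BackCell : ℕ → ℕ → Bool → Set
  BackCell i j d = ∃₂ λ α β → ∃₂ λ γ δ →
    Back i j α × Back (suc i) j β × Back i (suc j) γ × Back (suc i) (suc j) δ × Cell R′ α β γ δ d

  back-cell : ∀ {i j} → Below D (suc i) (suc j) → ∃ (BackCell i j)
  back-cell b with back (below-mono (n≤1+n _) (n≤1+n _) b)
  ... | α , border _ ¬b _    = contradiction b ¬b
  ... | α , inner b′ β γ δ k = _ , _ , _ , _ , _ , inner b′ β γ δ k , β , γ , δ , k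

  back-cell-unique : ∀ {i j d d′} → BackCell i j d → BackCell i j d′ → d ≡ d′
  back-cell-unique (_ , _ , _ , _ , _ , β , γ , δ , k) (_ , _ , _ , _ , _ , β′ , γ′ , δ′ , k′)
    with refl ← back-unique β β′ | refl ← back-unique γ γ′ | refl ← back-unique δ δ′
    = proj₂ (cell-back-unique k k′)

  back-cell-sym : ∀ {i j d} → BackCell i j d → BackCell j i d
  back-cell-sym (_ , _ , _ , _ , α , β , γ , δ , k) =
    _ , _ , _ , _ , back-sym α , back-sym γ , back-sym β , back-sym δ , cell-sym k

  D′ : Diagram
  D′ i j with below? I (suc i) (suc j)
  ... | yes b = proj₁ (back-cell b)
  ... | no _  = D i j

  D′-inside : ∀ {i j} → Below D (suc i) (suc j) → BackCell i j (D′ i j)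
  D′-inside {i} {j} b with below? I (suc i) (suc j)
  ... | yes b′ = proj₂ (back-cell b′)
  ... | no ¬b  = contradiction b ¬b

  D′-outside : ∀ {i j} → ¬ Below D (suc i) (suc j) → D i j ≡ D′ i j
  D′-outside {i} {j} ¬b with below? I (suc i) (suc j)
  ... | yes b = contradiction b ¬b
  ... | no _  = refl

  -- Reflecting a refilled cell yields a refilling of the mirror cell, and refillings are unique.
  D′-sym : ∀ i j → D′ i j ≡ D′ j i
  D′-sym i j with below? I (suc i) (suc j)
  ... | yes b = back-cell-unique (proj₂ (back-cell b)) (back-cell-sym (D′-inside (below-sym I b)))
  ... | no ¬b = trans (symmetric i j) (D′-outside (λ b → ¬b (below-sym I b)))

  grow′ : ∀ i j {α} → Back i j α → Grow R′ D′ i j α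
  grow′ i       zero    b with refl ← back-axis b = axisˡ
  grow′ zero    (suc j) b with refl ← back-axis (back-sym b) = axisʳ
  grow′ (suc i) (suc j) b with D′-inside (back-below b)
  ... | _ , _ , _ , _ , α , β , γ , δ , k with refl ← back-unique b δ =
    cell (grow′ i j α) (grow′ (suc i) j β) (grow′ i (suc j) γ) refl k

  -- A dot inside the region may disappear, but then some dot lies strictly above and to the right
  -- of it. Climbing this way ends, as rows are bounded by `n`, at a dot outside the region, which
  -- `D′` keeps.
  below⇒ : ∀ fuel {i j k l} → n ≤ fuel + k → i ≤ k → j ≤ l → Dot D k l → Below D′ i j
  below⇒ zero le i≤k j≤l dot = contradiction (<-≤-trans (bounded dot) le) (<-irrefl refl)
  below⇒ (suc fuel) {k = k} {l} le i≤k j≤l dot with below? I (suc k) (suc l)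
  ... | no ¬b = k , l , i≤k , j≤l , trans (sym (D′-outside ¬b)) dot
  ... | yes (k′ , l′ , k<k′ , l<l′ , dot′) =
    below⇒ fuel (≤-trans le (subst (_≤ fuel + k′) (+-suc fuel k) (+-monoʳ-≤ fuel k<k′)))
      (≤-trans i≤k (<⇒≤ k<k′)) (≤-trans j≤l (<⇒≤ l<l′)) dot′

  below⇐ : ∀ {i j} → Below D′ i j → Below D i j
  below⇐ (k , l , i≤k , j≤l , dot) with below? I (suc k) (suc l)
  ... | yes b = below-mono (m≤n⇒m≤1+n i≤k) (m≤n⇒m≤1+n j≤l) b
  ... | no _  = k , l , i≤k , j≤l , dot

  transfer : Transfer R R′ D D′
  transfer = record
    { below   = λ { (k , l , i≤k , j≤l , dot) → below⇒ n (m≤m+n n k) i≤k j≤l dot }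
    ; below′  = below⇐
    ; outside = D′-outside
    ; border  = λ b ¬b → let α , g = grow b in α , g , grow′ _ _ (border b ¬b g)
    ; grow    = grow
    ; grow′   = λ b → let α , g = back b in α , grow′ _ _ g
    }

  -- On the border both counts are the size of one common shape. Beyond it the cells are unchanged,
  -- and `count-cell` carries the equality outwards.
  same-count : ∀ i j → ¬ Below D (suc i) (suc j) → count D i j ≡ count D′ i j
  same-count i j ¬b′ with below? I i j
  ... | yes b = let α , g = grow b in
                trans (sym (grow-size g)) (grow-size (grow′ i j (border b ¬b′ g)))
  same-count zero    j       ¬b′ | no ¬b = refl
  same-count (suc i) zero    ¬b′ | no ¬b =
    trans (count-zero D (suc i)) (sym (count-zero D′ (suc i)))
  same-count (suc i) (suc j) ¬b′ | no ¬b = +-cancelʳ-≡ (count D i j) _ _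
    (trans (count-cell D i j) (trans
      (cong₂ _+_ (cong₂ _+_ (same-count (suc i) j λ b → ¬b (below-mono (n≤1+n _) ≤-refl b))
                            (same-count i (suc j) λ b → ¬b (below-mono ≤-refl (n≤1+n _) b)))
                 (cong bit (D′-outside ¬b)))
      (trans (sym (count-cell D′ i j)) (cong (count D′ (suc i) (suc j) +_)
        (sym (same-count i j ¬b))))))

  D′-bounded : ∀ {i j} → Dot D′ i j → i < n
  D′-bounded {i} {j} dot with below? I (suc i) (suc j)
  ... | yes b = <⇒≤ (below-row I b)
  ... | no _  = bounded dot

  -- No cell at column `n` lies in the region, so `same-count` applies at both ends of the row; the
  -- difference of the two counts is the row sum.
  D′-row : ∀ {i} → i < n → row D′ i n ≡ 1
  D′-row {i} i<n = +-cancelˡ-≡ (count D i n) _ _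
    (trans (cong (_+ row D′ i n) (same-count i n out))
    (trans (sym (same-count (suc i) n out))
           (cong (count D i n +_) (row≡1 I i<n))))
    where
    out : ∀ {i} → ¬ Below D i (suc n)
    out b = contradiction (below-col I b) (<⇒≯ (n<1+n n))

  involution : InvolutionDiagram n D′
  involution = record
    { symmetric = D′-sym
    ; unique    = λ {i} {j} {k} dotⱼ dotₖ → row-unique (D′-row (D′-bounded dotⱼ))
        (D′-bounded (trans (D′-sym j i) dotⱼ)) (D′-bounded (trans (D′-sym k i) dotₖ)) dotⱼ dotₖ
    ; bounded   = D′-bounded
    ; total     = λ {i} i<n →
        let c , _ , dot = row-find D′ i n (subst (0 <_) (sym (D′-row i<n)) z<s) in c , dot
    }

-- Injectivity of the transfer.

module _ {n : ℕ} {D₁ D₂ D′ : Diagram} {R R′ : Rule} (I : InvolutionDiagram n D₁)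
  (t₁ : Transfer R R′ D₁ D′) (t₂ : Transfer R R′ D₂ D′) where

  private
    module t₁ = Transfer t₁
    module t₂ = Transfer t₂

    below₂ : ∀ {i j} → Below D₁ i j → Below D₂ i j
    below₂ b = t₂.below′ (t₁.below b)

  Agree : ℕ → ℕ → Set
  Agree i j = ∀ {α α′} → Grow R D₁ i j α → Grow R D₂ i j α′ → α ≡ α′

  agree-cell : ∀ {i j} → Below D₁ (suc i) (suc j) →
    Agree (suc i) j → Agree i (suc j) → Agree (suc i) (suc j) → Agree i j × D₁ i j ≡ D₂ i j
  agree-cell b agβ agγ agδ with t₁.grow b | t₂.grow (below₂ b)
  ... | δ , g@(cell a₁ b₁ c₁ refl k₁) | δ′ , g′@(cell a₂ b₂ c₂ refl k₂)
    with refl ← agβ b₁ b₂ | refl ← agγ c₁ c₂ | refl ← agδ g g′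
    with α≡ , d≡ ← cell-back-unique k₁ k₂
    = (λ h h′ → trans (grow-unique h a₁) (trans α≡ (grow-unique a₂ h′))) , d≡

  -- On the border both shapes equal the one that `R′` grows from the common `D′`; inside, the
  -- backward determinism of `R` propagates equality down and to the left.
  agree : ∀ fuel {i j} → n + n ≤ fuel + (i + j) → Below D₁ i j → Agree i j
  agree zero le b =
    contradiction (<-≤-trans (+-mono-< (below-row I b) (below-col I b)) le) (<-irrefl refl)
  agree (suc fuel) {i} {j} le b with below? I (suc i) (suc j)
  ... | yes b′ = proj₁ (agree-cell b′
      (agree fuel le₁ (below-mono ≤-refl (n≤1+n _) b′))
      (agree fuel le₂ (below-mono (n≤1+n _) ≤-refl b′))
      (agree fuel (≤-trans le₂ (+-monoʳ-≤ fuel (n≤1+n _))) b′))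
    where
    le₁ : n + n ≤ fuel + suc (i + j)
    le₁ = subst (n + n ≤_) (sym (+-suc fuel (i + j))) le
    le₂ : n + n ≤ fuel + (i + suc j)
    le₂ = subst (λ m → n + n ≤ fuel + m) (sym (+-suc i j)) le₁
  ... | no ¬b′ with t₁.border b ¬b′
                  | t₂.border (below₂ b) (λ b₂ → ¬b′ (t₁.below′ (t₂.below b₂)))
  ... | α , g , g′ | α₂ , h , h′ = λ k k′ →
    trans (grow-unique k g) (trans (grow-unique g′ h′) (grow-unique h k′))

  transfer-injective : ∀ i j → D₁ i j ≡ D₂ i j
  transfer-injective i j with below? I (suc i) (suc j)
  ... | no ¬b = trans (t₁.outside ¬b)
                      (sym (t₂.outside λ b → ¬b (t₁.below′ (t₂.below b))))
  ... | yes b = proj₂ (agree-cell b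
      (agree (n + n) (m≤m+n _ _) (below-mono ≤-refl (n≤1+n _) b))
      (agree (n + n) (m≤m+n _ _) (below-mono (n≤1+n _) ≤-refl b))
      (agree (n + n) (m≤m+n _ _) b))

-- Triples of dots and longest increasing chains.

record Increasing₃ (D : Diagram) (i j : ℕ) : Set where
  constructor increasing₃
  field
    {r₁ r₂ r₃ c₁ c₂ c₃} : ℕ
    r₁<r₂ : r₁ < r₂
    r₂<r₃ : r₂ < r₃
    r₃<i  : r₃ < i
    c₁<c₂ : c₁ < c₂
    c₂<c₃ : c₂ < c₃
    c₃<j  : c₃ < j
    dot₁  : Dot D r₁ c₁
    dot₂  : Dot D r₂ c₂
    dot₃  : Dot D r₃ c₃

record Decreasing₃ (D : Diagram) (i j : ℕ) : Set where
  constructor decreasing₃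
  field
    {r₁ r₂ r₃ c₁ c₂ c₃} : ℕ
    r₁<r₂ : r₁ < r₂
    r₂<r₃ : r₂ < r₃
    r₃<i  : r₃ < i
    c₃<c₂ : c₃ < c₂
    c₂<c₁ : c₂ < c₁
    c₁<j  : c₁ < j
    dot₁  : Dot D r₁ c₁
    dot₂  : Dot D r₂ c₂
    dot₃  : Dot D r₃ c₃

-- The length of a longest chain of dots, each strictly above and to the right of the
-- previous one, in the rectangle below (i , j).

lis : Diagram → ℕ → ℕ → ℕ
lis D zero    j       = 0
lis D (suc i) zero    = 0
lis D (suc i) (suc j) = if D i j then suc (lis D i j) else lis D (suc i) j ⊔ lis D i (suc j)

module _ (D : Diagram) where

  lis-zero : ∀ i → lis D i 0 ≡ 0
  lis-zero zero    = refl
  lis-zero (suc i) = refl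

  lis-dot : ∀ {i j} → Dot D i j → lis D (suc i) (suc j) ≡ suc (lis D i j)
  lis-dot dot rewrite dot = refl

  -- At a dot `lis` ignores both neighbouring values, so monotonicity there rests on this bound;
  -- conversely the bound rests on monotonicity, hence the mutual induction.
  lis-sucʳ-≤ : ∀ i j → lis D i (suc j) ≤ suc (lis D i j)
  lis-≤-sucˡ : ∀ i j → lis D i j ≤ lis D (suc i) j

  lis-sucʳ-≤ zero    j = z≤n
  lis-sucʳ-≤ (suc i) j with D i j
  ... | true  = s≤s (lis-≤-sucˡ i j)
  ... | false = ⊔-lub (n≤1+n _) (≤-trans (lis-sucʳ-≤ i j) (s≤s (lis-≤-sucˡ i j)))

  lis-≤-sucˡ i zero    = ≤-reflexive (lis-zero i)
  lis-≤-sucˡ i (suc j) with D i j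
  ... | true  = lis-sucʳ-≤ i j
  ... | false = m≤n⊔m _ _

  lis-monoˡ : ∀ {i i′} j → i ≤ i′ → lis D i j ≤ lis D i′ j
  lis-monoˡ {i} {i′} j i≤i′ with m≤n⇒m<n∨m≡n i≤i′
  ... | inj₂ refl = ≤-refl
  lis-monoˡ {i} {suc i′} j _ | inj₁ i<1+i′ =
    ≤-trans (lis-monoˡ j (s≤s⁻¹ i<1+i′)) (lis-≤-sucˡ i′ j)

module _ {D : Diagram} (D-sym : ∀ i j → D i j ≡ D j i) where

  lis-sym : ∀ i j → lis D i j ≡ lis D j i
  lis-sym zero    zero    = refl
  lis-sym zero    (suc j) = refl
  lis-sym (suc i) zero    = refl
  lis-sym (suc i) (suc j) rewrite D-sym j i | lis-sym i j | lis-sym (suc i) j | lis-sym i (suc j)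
    with D i j
  ... | true  = refl
  ... | false = ⊔-comm (lis D j (suc i)) _

  lis-monoʳ : ∀ i {j j′} → j ≤ j′ → lis D i j ≤ lis D i j′
  lis-monoʳ i {j} {j′} j≤j′ = subst₂ _≤_ (lis-sym j i) (lis-sym j′ i) (lis-monoˡ D i j≤j′)

  lis-mono : ∀ {i i′ j j′} → i ≤ i′ → j ≤ j′ → lis D i j ≤ lis D i′ j′
  lis-mono {i} {i′} {j} {j′} i≤ j≤ = ≤-trans (lis-monoˡ D j i≤) (lis-monoʳ i′ j≤)

  -- The last dot of a chain avoids the empty block, so it lies left of column `p` or below row `q`,
  -- and the whole chain lies on the same side.
  lis-empty-block : ∀ {p q} i j →
    (∀ {r c} → q ≤ r → r < i → p ≤ c → c < j → ¬ Dot D r c) → lis D i j ≤ lis D i p ⊔ lis D q j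
  lis-empty-block {p} {q} i j empty with i ≤? q | j ≤? p
  ... | yes i≤q | _       = ≤-trans (lis-monoˡ D j i≤q) (m≤n⊔m (lis D i p) _)
  ... | no _    | yes j≤p = ≤-trans (lis-monoʳ i j≤p) (m≤m⊔n (lis D i p) _)
  lis-empty-block {p} {q} (suc i) zero    empty | no _ | no j≰p = contradiction z≤n j≰p
  lis-empty-block {p} {q} zero    j       empty | no i≰q | no _ = contradiction z≤n i≰q
  lis-empty-block {p} {q} (suc i) (suc j) empty | no i≰q | no j≰p with D i j in eq
  ... | true  = contradiction eq
    (empty (s≤s⁻¹ (≰⇒> i≰q)) ≤-refl (s≤s⁻¹ (≰⇒> j≰p)) ≤-refl)
  ... | false = ⊔-lub
    (≤-trans (lis-empty-block (suc i) j λ q≤r r<i p≤c c<j → empty q≤r r<i p≤c (m≤n⇒m≤1+n c<j))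
             (⊔-monoʳ-≤ (lis D (suc i) p) (lis-monoʳ q (n≤1+n j))))
    (≤-trans (lis-empty-block i (suc j) λ q≤r r<i p≤c c<j → empty q≤r (m≤n⇒m≤1+n r<i) p≤c c<j)
             (⊔-monoˡ-≤ (lis D q (suc j)) (lis-≤-sucˡ D i p)))

-- The row rule and decreasing triples.

firstRow : Shape → ℕ
firstRow (b , h) = b + h

firstRow-edge : ∀ {α β} → Edge α β → firstRow α ≤ firstRow β
firstRow-edge none               = ≤-refl
firstRow-edge (step (one {b}))     = +-monoʳ-≤ b (n≤1+n _)
firstRow-edge (step (two {b} {h})) = ≤-reflexive (+-suc b h)

-- The first row obeys the recursion that defines `lis`, which gives Schensted's theorem cell by
-- cell.
firstRow-cell : ∀ {α β γ δ d} → Cell rowRule α β γ δ d →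
  firstRow δ ≡ (if d then suc (firstRow α) else firstRow β ⊔ firstRow γ)
firstRow-cell (flatˡ e) = sym (m≤n⇒m⊔n≡n (firstRow-edge e))
firstRow-cell (flatʳ e) = sym (m≥n⇒m⊔n≡m (firstRow-edge e))
firstRow-cell (cross {b} {h}) rewrite +-suc b (suc h) | +-suc b h =
  sym (m≥n⇒m⊔n≡m (n≤1+n _))
firstRow-cell (cross′ {b} {h}) rewrite +-suc b (suc h) | +-suc b h =
  sym (m≤n⇒m⊔n≡n (n≤1+n _))
firstRow-cell (corner (insert {b} {h})) = +-suc b h
firstRow-cell (corner (bump {b} {h})) = sym (trans (⊔-idem (b + suc h)) (+-suc b h))

grow-lis : ∀ {D i j α} → Grow rowRule D i j α → firstRow α ≡ lis D i j
grow-lis {D} {i} axisˡ = sym (lis-zero D i)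
grow-lis axisʳ = refl
grow-lis {D} (cell {i} {j} a b c refl k)
  rewrite firstRow-cell k | grow-lis a | grow-lis b | grow-lis c = refl

firstRow-two : ∀ {b h} → firstRow (suc b , h) ≡ firstRow (b , suc h)
firstRow-two {b} {h} = sym (+-suc b h)

module _ {n : ℕ} {D : Diagram} (I : InvolutionDiagram n D) where
  open InvolutionDiagram I

  unique′ : ∀ {i j k} → Dot D i k → Dot D j k → i ≡ j
  unique′ dot dot′ = unique (flip-dot dot) (flip-dot dot′)

  -- A step would require a second dot in row `i`, to the left of column `j`.
  dot-flat : ∀ {R i j α β} → Grow R D i j α → Grow R D (suc i) j β → Dot D i j → α ≡ β
  dot-flat g g′ dot with grow-edge g g′
  ... | none    = refl
  ... | step st with c , c<j , dot′ ← step-dot g g′ st =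
    contradiction (unique dot′ dot) (<⇒≢ c<j)

  -- With a dot in row i at column p and one in column j at row q, the block between them
  -- is empty, so a longest chain extends past one of them.
  no-overflow : ∀ {i j p q} → ¬ Decreasing₃ D (suc i) (suc j) →
    p < j → Dot D i p → q < i → Dot D q j →
    lis D (suc i) j ≡ lis D i j → ¬ (lis D i (suc j) ≡ lis D i j)
  no-overflow {i} {j} {p} {q} avoid p<j dotᵢ q<i dotⱼ eq eq′ =
    <-irrefl refl (≤-<-trans (lis-empty-block symmetric {p} {q} i j empty) (⊔-pres-<m left right))
    where
    left : lis D i p < lis D i j
    left = subst₂ _≤_ (lis-dot D dotᵢ) eq (lis-monoʳ symmetric (suc i) p<j)
    right : lis D q j < lis D i j
    right = subst₂ _≤_ (lis-dot D dotⱼ) eq′ (lis-monoˡ D (suc j) q<i)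
    empty : ∀ {r c} → q ≤ r → r < i → p ≤ c → c < j → ¬ Dot D r c
    empty {r} {c} q≤r r<i p≤c c<j dot =
      avoid (decreasing₃ (≤∧≢⇒< q≤r q≢r) r<i ≤-refl (≤∧≢⇒< p≤c p≢c) c<j ≤-refl dotⱼ dot dotᵢ)
      where
      q≢r : q ≢ r
      q≢r refl = contradiction (unique dot dotⱼ) (<⇒≢ c<j)
      p≢c : p ≢ c
      p≢c refl = contradiction (unique′ dot dotᵢ) (<⇒≢ r<i)

  decreasing-free⇒grow : ∀ i j → ¬ Decreasing₃ D i j → ∃ λ α → Grow rowRule D i j α
  decreasing-free⇒grow zero    j       avoid = _ , axisʳ
  decreasing-free⇒grow (suc i) zero    avoid = _ , axisˡ
  decreasing-free⇒grow (suc i) (suc j) avoid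
    with α , a ← decreasing-free⇒grow i j (λ { (decreasing₃ x y z u v w d₁ d₂ d₃) →
           avoid (decreasing₃ x y (m≤n⇒m≤1+n z) u v (m≤n⇒m≤1+n w) d₁ d₂ d₃) })
       | β , b ← decreasing-free⇒grow (suc i) j (λ { (decreasing₃ x y z u v w d₁ d₂ d₃) →
           avoid (decreasing₃ x y z u v (m≤n⇒m≤1+n w) d₁ d₂ d₃) })
       | γ , c ← decreasing-free⇒grow i (suc j) (λ { (decreasing₃ x y z u v w d₁ d₂ d₃) →
           avoid (decreasing₃ x y (m≤n⇒m≤1+n z) u v w d₁ d₂ d₃) })
    with D i j in eq
  ... | true with refl ← dot-flat a b eq
                | refl ← dot-flat (grow-sym symmetric a) (grow-sym symmetric c) (flip-dot eq)
      = _ , cell a b c eq (corner insert)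
  ... | false with grow-edge a b | grow-edge (grow-sym symmetric a) (grow-sym symmetric c)
  ... | none     | e        = _ , cell a b c eq (flatˡ e)
  ... | e        | none     = _ , cell a b c eq (flatʳ e)
  ... | step one | step one = _ , cell a b c eq (corner bump)
  ... | step one | step two = _ , cell a b c eq cross
  ... | step two | step one = _ , cell a b c eq cross′
  -- The missing corner. Each step comes from a dot, one to the left in row `i` and one below in
  -- column `j`, while neither lengthens the first row, that is, `lis`.
  ... | step two | step two
    with p , p<j , dotᵢ ← step-dot a b two
       | q , q<i , dotⱼ ← step-dot (grow-sym symmetric a) (grow-sym symmetric c) two
    = contradiction (trans (sym (grow-lis c)) (trans firstRow-two (grow-lis a)))
        (no-overflow avoid p<j dotᵢ q<i (flip-dot dotⱼ)
          (trans (sym (grow-lis b)) (trans firstRow-two (grow-lis a))))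

  -- As no triple ends in an earlier row, all dots to the left of the third dot lie below the
  -- second dot, so a chain ending in the third dot is no longer than one ending in the second.
  row-idle : ∀ {i j r c p} → ¬ Decreasing₃ D i (suc j) → r < i → p < c → c < j →
    Dot D i p → Dot D r c → (∃ λ q → q < r × Dot D q j) → lis D (suc i) j ≤ lis D i j
  row-idle {i} {j} {r} {c} {p} avoid r<i p<c c<j dotᵢ dot (q , q<r , dotⱼ) =
    ≤-trans (lis-empty-block symmetric {suc p} {i} (suc i) j rest) (⊔-lub shorter ≤-refl)
    where
    rest : ∀ {r′ c′} → i ≤ r′ → r′ < suc i → suc p ≤ c′ → c′ < j → ¬ Dot D r′ c′
    rest i≤r′ r′<1+i p<c′ _ dot′ with refl ← ≤-antisym i≤r′ (s≤s⁻¹ r′<1+i) =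
      contradiction (unique dotᵢ dot′) (<⇒≢ p<c′)
    empty : ∀ {r′ c′} → r ≤ r′ → r′ < i → 0 ≤ c′ → c′ < p → ¬ Dot D r′ c′
    empty {r′} {c′} r≤r′ r′<i _ c′<p dot′ = avoid
      (decreasing₃ q<r (≤∧≢⇒< r≤r′ r≢r′) r′<i (<-trans c′<p p<c) c<j ≤-refl dotⱼ dot dot′)
      where
      r≢r′ : r ≢ r′
      r≢r′ refl = contradiction (unique dot′ dot) (<⇒≢ (<-trans c′<p p<c))
    below-second : lis D i p ≤ lis D r c
    below-second = ≤-trans (lis-empty-block symmetric {0} {r} i p empty)
      (subst (λ m → m ⊔ lis D r p ≤ lis D r c) (sym (lis-zero D i))
        (lis-monoʳ symmetric r (<⇒≤ p<c)))
    shorter : lis D (suc i) (suc p) ≤ lis D i j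
    shorter = subst (_≤ lis D i j) (sym (lis-dot D dotᵢ)) (≤-trans (s≤s below-second)
      (subst (_≤ lis D i j) (lis-dot D dot) (lis-mono symmetric r<i c<j)))

  -- The dot forces a box to be added, and a box in the first row would increase `lis`.
  idle⇒two : ∀ {i j c α β} → Grow rowRule D i j α → Grow rowRule D (suc i) j β →
    c < j → Dot D i c → lis D (suc i) j ≤ lis D i j →
    ∃₂ λ b h → α ≡ (b , suc h) × β ≡ (suc b , h)
  idle⇒two {i} {j} g g′ c<j dot le with dot-step g g′ c<j dot
  ... | two = _ , _ , refl , refl
  ... | one {b} {h} = contradiction
    (subst (_≤ lis D i j) (trans (sym (grow-lis g′)) (trans (+-suc b h) (cong suc (grow-lis g)))) le)
    1+n≰n

  flip-decreasing : ∀ {i j} → Decreasing₃ D i j → Decreasing₃ D j i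
  flip-decreasing (decreasing₃ x y z u v w d₁ d₂ d₃) =
    decreasing₃ u v w x y z (flip-dot d₃) (flip-dot d₂) (flip-dot d₁)

  -- Smaller rectangles are free by induction, so the triple has its third dot in the top row and
  -- its first in the rightmost column. `row-idle`, used for rows and in transposed form for
  -- columns, makes both edges second-row steps, which no cell of this rule allows.
  grow⇒decreasing-free : ∀ {i j α} → Grow rowRule D i j α → ¬ Decreasing₃ D i j
  grow⇒decreasing-free axisˡ (decreasing₃ _ _ _ _ _ () _ _ _)
  grow⇒decreasing-free axisʳ (decreasing₃ _ _ () _ _ _ _ _ _)
  grow⇒decreasing-free (cell a b c refl k) (decreasing₃ x y z u v w d₁ d₂ d₃)
    with m≤n⇒m<n∨m≡n (s≤s⁻¹ z) | m≤n⇒m<n∨m≡n (s≤s⁻¹ w)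
  ... | inj₁ r₃<i | _         = grow⇒decreasing-free c (decreasing₃ x y r₃<i u v w d₁ d₂ d₃)
  ... | inj₂ _    | inj₁ c₁<j = grow⇒decreasing-free b (decreasing₃ x y z u v c₁<j d₁ d₂ d₃)
  ... | inj₂ refl | inj₂ refl
    with _ , _ , refl , refl ← idle⇒two a b (<-trans u v) d₃
           (row-idle (grow⇒decreasing-free c) y u v d₃ d₂ (_ , x , d₁))
       | _ , _ , refl , refl ← idle⇒two (grow-sym symmetric a) (grow-sym symmetric c)
           (<-trans x y) (flip-dot d₁)
           (row-idle (λ dec → grow⇒decreasing-free b (flip-decreasing dec)) v x y
             (flip-dot d₁) (flip-dot d₂) (_ , u , flip-dot d₃))
    with corner () ← k

-- The column rule and increasing triples.

count-dot : ∀ {D i j r c} → r < i → c < j → Dot D r c → 0 < count D i j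
count-dot {D} {suc i} {j} r<1+i c<j dot with m≤n⇒m<n∨m≡n (s≤s⁻¹ r<1+i)
... | inj₁ r<i  = ≤-trans (count-dot r<i c<j dot) (m≤m+n _ _)
... | inj₂ refl = ≤-trans (row-dot c<j dot) (m≤n+m _ (count D i j))

count-find : ∀ D i j → 0 < count D i j → ∃₂ λ r c → r < i × c < j × Dot D r c
count-find D (suc i) j pos with row D i j in eq
... | suc _ with c , c<j , dot ← row-find D i j (subst (0 <_) (sym eq) z<s) =
  i , c , ≤-refl , c<j , dot
... | zero with r , c , r<i , c<j , dot ← count-find D i j (subst (0 <_) (+-identityʳ _) pos) =
  r , c , m≤n⇒m≤1+n r<i , c<j , dot

record Increasing₂ (D : Diagram) (i j : ℕ) : Set where
  constructor increasing₂
  field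
    {r₁ r₂ c₁ c₂} : ℕ
    r₁<r₂ : r₁ < r₂
    r₂<i  : r₂ < i
    c₁<c₂ : c₁ < c₂
    c₂<j  : c₂ < j
    dot₁  : Dot D r₁ c₁
    dot₂  : Dot D r₂ c₂

module _ {D : Diagram} where

  increasing₂-mono : ∀ {i i′ j j′} → i ≤ i′ → j ≤ j′ → Increasing₂ D i j → Increasing₂ D i′ j′
  increasing₂-mono i≤ j≤ (increasing₂ x y u v d₁ d₂) =
    increasing₂ x (≤-trans y i≤) u (≤-trans v j≤) d₁ d₂

  increasing₃-mono : ∀ {i i′ j j′} → i ≤ i′ → j ≤ j′ → Increasing₃ D i j → Increasing₃ D i′ j′
  increasing₃-mono i≤ j≤ (increasing₃ x y z u v w d₁ d₂ d₃) =
    increasing₃ x y (≤-trans z i≤) u v (≤-trans w j≤) d₁ d₂ d₃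

  -- Only `insert₂` opens a second column, at a dot over a nonempty shape, and nonempty means an
  -- earlier dot below and to the left. Every other cell inherits the second column from a
  -- neighbour.
  second⇒increasing₂ : ∀ {i j b h} → Grow columnRule D i j (suc b , h) → Increasing₂ D i j
  second⇒increasing₂ (cell a b c _ (flatˡ _)) =
    increasing₂-mono (n≤1+n _) ≤-refl (second⇒increasing₂ c)
  second⇒increasing₂ (cell a b c _ (flatʳ _)) =
    increasing₂-mono ≤-refl (n≤1+n _) (second⇒increasing₂ b)
  second⇒increasing₂ (cell a b c _ cross) =
    increasing₂-mono (n≤1+n _) ≤-refl (second⇒increasing₂ c)
  second⇒increasing₂ (cell a b c _ cross′) =
    increasing₂-mono ≤-refl (n≤1+n _) (second⇒increasing₂ b)
  second⇒increasing₂ (cell {i} {j} a b c dot (corner insert₂))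
    with _ , _ , r<i , c<j , dot′ ← count-find D i j (subst (0 <_) (grow-size a) z<s)
    = increasing₂ r<i ≤-refl c<j ≤-refl dot′ dot
  second⇒increasing₂ (cell a b c _ (corner bump₁)) =
    increasing₂-mono ≤-refl (n≤1+n _) (second⇒increasing₂ b)
  second⇒increasing₂ (cell a b c _ (corner bump₂)) =
    increasing₂-mono ≤-refl (n≤1+n _) (second⇒increasing₂ b)
  second⇒increasing₂ (cell a b c _ (corner wrap)) =
    increasing₂-mono ≤-refl (n≤1+n _) (second⇒increasing₂ b)

  edge-second : ∀ {α β} → Edge α β → proj₁ α ≤ proj₁ β
  edge-second none       = ≤-refl
  edge-second (step one) = ≤-refl
  edge-second (step two) = n≤1+n _

  increasing₂⇒second : ∀ {i j α} → Grow columnRule D i j α → Increasing₂ D i j → 0 < proj₁ α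
  increasing₂⇒second axisˡ (increasing₂ _ _ _ () _ _)
  increasing₂⇒second axisʳ (increasing₂ _ () _ _ _ _)
  increasing₂⇒second (cell a b c eq k) (increasing₂ x y u v d₁ d₂)
    with m≤n⇒m<n∨m≡n (s≤s⁻¹ y) | m≤n⇒m<n∨m≡n (s≤s⁻¹ v)
  ... | inj₁ r₂<i | _         =
    ≤-trans (increasing₂⇒second c (increasing₂ x r₂<i u v d₁ d₂)) (edge-second (right-edge k))
  ... | inj₂ _    | inj₁ c₂<j =
    ≤-trans (increasing₂⇒second b (increasing₂ x y u c₂<j d₁ d₂))
            (edge-second (right-edge (cell-sym k)))
  ... | inj₂ refl | inj₂ refl with refl ← trans (sym eq) d₂ | k
  ...   | corner insert₁ = contradiction (subst (0 <_) (sym (grow-size a)) (count-dot x u d₁)) n≮0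
  ...   | corner insert₂ = z<s

  grow⇒increasing-free : ∀ {i j α} → Grow columnRule D i j α → ¬ Increasing₃ D i j
  grow⇒increasing-free axisˡ (increasing₃ _ _ _ _ _ () _ _ _)
  grow⇒increasing-free axisʳ (increasing₃ _ _ () _ _ _ _ _ _)
  grow⇒increasing-free (cell a b c eq k) (increasing₃ x y z u v w d₁ d₂ d₃)
    with m≤n⇒m<n∨m≡n (s≤s⁻¹ z) | m≤n⇒m<n∨m≡n (s≤s⁻¹ w)
  ... | inj₁ r₃<i | _         = grow⇒increasing-free c (increasing₃ x y r₃<i u v w d₁ d₂ d₃)
  ... | inj₂ _    | inj₁ c₃<j = grow⇒increasing-free b (increasing₃ x y z u v c₃<j d₁ d₂ d₃)
  ... | inj₂ refl | inj₂ refl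
    with refl ← trans (sym eq) d₃ | pos ← increasing₂⇒second a (increasing₂ x y u v d₁ d₂) | k
  ...   | corner insert₁ = n≮0 pos
  ...   | corner insert₂ = n≮0 pos

module _ {n : ℕ} {D : Diagram} (I : InvolutionDiagram n D) where
  open InvolutionDiagram I

  -- Without a dot every pair of edges has a cell. At a dot only a second column obstructs, and then
  -- the dot completes an increasing pair to a triple.
  increasing-free⇒grow : ∀ i j → ¬ Increasing₃ D i j → ∃ λ α → Grow columnRule D i j α
  increasing-free⇒grow zero    j       avoid = _ , axisʳ
  increasing-free⇒grow (suc i) zero    avoid = _ , axisˡ
  increasing-free⇒grow (suc i) (suc j) avoid
    with α , a ← increasing-free⇒grow i j (λ inc →
           avoid (increasing₃-mono (n≤1+n i) (n≤1+n j) inc))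
       | β , b ← increasing-free⇒grow (suc i) j (λ inc →
           avoid (increasing₃-mono ≤-refl (n≤1+n j) inc))
       | γ , c ← increasing-free⇒grow i (suc j) (λ inc →
           avoid (increasing₃-mono (n≤1+n i) ≤-refl inc))
    with D i j in eq
  ... | true with refl ← dot-flat I a b eq
                | refl ← dot-flat I (grow-sym symmetric a) (grow-sym symmetric c) (flip-dot eq)
                | α
  ...   | 0 , 0     = _ , cell a b c eq (corner insert₁)
  ...   | 0 , suc h = _ , cell a b c eq (corner insert₂)
  ...   | suc _ , _ with increasing₂ x y u v d₁ d₂ ← second⇒increasing₂ a =
    contradiction (increasing₃ x y ≤-refl u v ≤-refl d₁ d₂ eq) avoid
  increasing-free⇒grow (suc i) (suc j) avoid | false
    with grow-edge a b | grow-edge (grow-sym symmetric a) (grow-sym symmetric c)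
  ... | none     | e        = _ , cell a b c eq (flatˡ e)
  ... | e        | none     = _ , cell a b c eq (flatʳ e)
  ... | step one | step one = _ , cell a b c eq (corner bump₁)
  ... | step one | step two = _ , cell a b c eq cross
  ... | step two | step one = _ , cell a b c eq cross′
  ... | step (two {h = zero})  | step two = _ , cell a b c eq (corner wrap)
  ... | step (two {h = suc _}) | step two = _ , cell a b c eq (corner bump₂)

-- Passing between self-maps and their matrices.

does⇒ : ∀ {A : Set} (a? : Dec A) → does a? ≡ true → A
does⇒ (yes a) _ = a

diagram : ∀ {n} → (Fin n → Fin n) → Diagram
diagram f i j = does (any? λ a → (toℕ a ≟ i) ×-dec (toℕ (f a) ≟ j))

module _ {n : ℕ} {f : Fin n → Fin n} where

  diagram-dot : ∀ a → Dot (diagram f) (toℕ a) (toℕ (f a))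
  diagram-dot a = dec-true (any? _) (a , refl , refl)

  below-dot : ∀ a → Below (diagram f) (toℕ a) (toℕ (f a))
  below-dot a = _ , _ , ≤-refl , ≤-refl , diagram-dot a

  dot-diagram : ∀ {i j} → Dot (diagram f) i j → ∃ λ a → toℕ a ≡ i × toℕ (f a) ≡ j
  dot-diagram = does⇒ (any? _)

  diagram-involution : Involutive _≡_ f → InvolutionDiagram n (diagram f)
  diagram-involution inv = record
    { symmetric = λ i j → Bool.⇔→≡ (mk⇔ flipped flipped)
    ; unique    = λ dotⱼ dotₖ → case (dot-diagram dotⱼ , dot-diagram dotₖ) of λ
        { ((a , refl , refl) , (b , eq , refl)) → cong (toℕ ∘ f) (toℕ-injective (sym eq)) }
    ; bounded   = λ dot → case dot-diagram dot of λ { (a , refl , _) → toℕ<n a }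
    ; total     = λ i<n → _ , subst (λ i → Dot (diagram f) i (toℕ (f (fromℕ< i<n))))
                                    (toℕ-fromℕ< i<n) (diagram-dot (fromℕ< i<n))
    }
    where
    flipped : ∀ {i j} → Dot (diagram f) i j → Dot (diagram f) j i
    flipped dot with a , refl , refl ← dot-diagram dot =
      subst (Dot (diagram f) (toℕ (f a)) ∘ toℕ) (inv a) (diagram-dot (f a))

module _ {n : ℕ} {f g : Fin n → Fin n} where

  diagram-cong : f ≗ g → ∀ i j → diagram f i j ≡ diagram g i j
  diagram-cong f≗g i j = Bool.⇔→≡ (mk⇔ (respects f≗g) (respects (sym ∘ f≗g)))
    where
    respects : ∀ {f g : Fin n → Fin n} → f ≗ g → Dot (diagram f) i j → Dot (diagram g) i j
    respects {f} {g} f≗g dot with a , refl , refl ← dot-diagram {f = f} dot =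
      subst (Dot (diagram g) (toℕ a) ∘ toℕ) (sym (f≗g a)) (diagram-dot {f = g} a)

  diagram-injective : (∀ i j → diagram f i j ≡ diagram g i j) → f ≗ g
  diagram-injective eq a
    with b , b≡a , fb≡ ← dot-diagram {f = g} (trans (sym (eq _ _)) (diagram-dot {f = f} a))
    with refl ← toℕ-injective b≡a = sym (toℕ-injective fb≡)

module _ {n : ℕ} {D : Diagram} (I : InvolutionDiagram n D) where
  open InvolutionDiagram I

  toInvolution : Fin n → Fin n
  toInvolution a = fromℕ< (bounded (flip-dot (proj₂ (total (toℕ<n a)))))

  toInvolution-dot : ∀ a → Dot D (toℕ a) (toℕ (toInvolution a))
  toInvolution-dot a = subst (Dot D (toℕ a)) (sym (toℕ-fromℕ< _)) (proj₂ (total (toℕ<n a)))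

  diagram-toInvolution : ∀ i j → D i j ≡ diagram toInvolution i j
  diagram-toInvolution i j = Bool.⇔→≡ (mk⇔ to from)
    where
    to : Dot D i j → Dot (diagram toInvolution) i j
    to dot = subst₂ (Dot (diagram toInvolution)) i≡ j≡ (diagram-dot {f = toInvolution} a)
      where
      a  = fromℕ< (bounded dot)
      i≡ = toℕ-fromℕ< (bounded dot)
      j≡ = unique (subst (λ r → Dot D r (toℕ (toInvolution a))) i≡ (toInvolution-dot a)) dot
    from : Dot (diagram toInvolution) i j → Dot D i j
    from dot with a , refl , refl ← dot-diagram {f = toInvolution} dot = toInvolution-dot a

  toInvolution-involutive : Involutive _≡_ toInvolution
  toInvolution-involutive a = toℕ-injective
    (unique (toInvolution-dot (toInvolution a)) (flip-dot (toInvolution-dot a)))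

module _ {D D′ : Diagram} (D≡D′ : ∀ i j → D i j ≡ D′ i j) where

  grow-resp : ∀ {R i j α} → Grow R D i j α → Grow R D′ i j α
  grow-resp axisˡ = axisˡ
  grow-resp axisʳ = axisʳ
  grow-resp (cell a b c eq k) =
    cell (grow-resp a) (grow-resp b) (grow-resp c) (trans (sym (D≡D′ _ _)) eq) k

  below-resp : ∀ {i j} → Below D i j → Below D′ i j
  below-resp (k , l , i≤k , j≤l , dot) = k , l , i≤k , j≤l , trans (sym (D≡D′ k l)) dot

transfer-respʳ : ∀ {R R′ D₀ D D′} → (∀ i j → D i j ≡ D′ i j) →
                 Transfer R R′ D₀ D → Transfer R R′ D₀ D′
transfer-respʳ D≡D′ t = record
  { below   = λ b → below-resp D≡D′ (below b)
  ; below′  = λ b → below′ (below-resp (λ i j → sym (D≡D′ i j)) b)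
  ; outside = λ ¬b → trans (outside ¬b) (D≡D′ _ _)
  ; border  = λ b ¬b → let α , g , g′ = border b ¬b in α , g , grow-resp D≡D′ g′
  ; grow    = grow
  ; grow′   = λ b → let α , g = grow′ b in α , grow-resp D≡D′ g
  }
  where open Transfer t

-- Pattern avoidance in terms of growth.

record Detects (R : Rule) (σ : Permutation′ 4) : Set where
  field
    avoids⇒grow : ∀ {n} {f : Fin n → Fin n} (inv : Involutive _≡_ f) →
      Avoids (fromInvolutive f inv) σ →
      ∀ {i j} → Below (diagram f) i j → ∃ λ α → Grow R (diagram f) i j α
    grow⇒avoids : ∀ {n} {f : Fin n → Fin n} (inv : Involutive _≡_ f) →
      (∀ {i j} → Below (diagram f) i j → ∃ λ α → Grow R (diagram f) i j α) →
      Avoids (fromInvolutive f inv) σ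

monotone₄ : ∀ {n} (f : Fin 4 → Fin n) → f 0F Fin.< f 1F → f 1F Fin.< f 2F → f 2F Fin.< f 3F →
            Monotonic₁ Fin._<_ Fin._<_ f
monotone₄ f f₀<f₁ f₁<f₂ f₂<f₃ {x} {y} x<y = go x y x<y
  where
  go : ∀ x y → x Fin.< y → f x Fin.< f y
  go 0F 1F _ = f₀<f₁
  go 0F 2F _ = <-trans f₀<f₁ f₁<f₂
  go 0F 3F _ = <-trans f₀<f₁ (<-trans f₁<f₂ f₂<f₃)
  go 1F 2F _ = f₁<f₂
  go 1F 3F _ = <-trans f₁<f₂ f₂<f₃
  go 2F 3F _ = f₂<f₃
  go 1F 1F (s≤s ())
  go 2F 1F (s≤s ())
  go 2F 2F (s≤s (s≤s ()))
  go 3F 1F (s≤s ())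
  go 3F 2F (s≤s (s≤s ()))
  go 3F 3F (s≤s (s≤s (s≤s ())))

module _ {n k : ℕ} (π : Permutation′ n) (σ : Permutation′ k)
  (σ-inv : Involutive _≡_ (σ ⟨$⟩ʳ_)) where

  -- Since `σ` is its own inverse, precomposing with it lists the letters by increasing value, which
  -- turns the order condition into a single chain of inequalities.
  occurrence : (ι : Fin k → Fin n) → Monotonic₁ Fin._<_ Fin._<_ ι →
    Monotonic₁ Fin._<_ Fin._<_ (λ a → π ⟨$⟩ʳ ι (σ ⟨$⟩ʳ a)) → Occurrence π σ ι
  occurrence ι ι-mono mono = ι-mono , λ a b → mk⇔ (reflect a b) (preserve a b)
    where
    preserve : ∀ a b → σ ⟨$⟩ʳ a Fin.< σ ⟨$⟩ʳ b → π ⟨$⟩ʳ ι a Fin.< π ⟨$⟩ʳ ι b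
    preserve a b lt =
      subst₂ (λ x y → π ⟨$⟩ʳ ι x Fin.< π ⟨$⟩ʳ ι y) (σ-inv a) (σ-inv b) (mono lt)
    reflect : ∀ a b → π ⟨$⟩ʳ ι a Fin.< π ⟨$⟩ʳ ι b → σ ⟨$⟩ʳ a Fin.< σ ⟨$⟩ʳ b
    reflect a b lt with Fin.<-cmp (σ ⟨$⟩ʳ a) (σ ⟨$⟩ʳ b)
    ... | tri< σa<σb _ _ = σa<σb
    ... | tri> _ _ σb<σa = contradiction (preserve b a σb<σa) (<-asym lt)
    ... | tri≈ _ σa≡σb _ with refl ← trans (sym (σ-inv a)) (trans (cong (σ ⟨$⟩ʳ_) σa≡σb) (σ-inv b)) =
      contradiction lt (<-irrefl refl)

module _ {n : ℕ} {f : Fin n → Fin n} (inv : Involutive _≡_ f) where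

  contains-1234 : ∀ {i j} → Increasing₃ (diagram f) i j → Below (diagram f) i j →
                  Contains (fromInvolutive f inv) p1234
  contains-1234 (increasing₃ x y z u v w d₁ d₂ d₃) (_ , _ , i≤k , j≤l , d₄)
    with a , refl , refl ← dot-diagram {f = f} d₁ | b , refl , refl ← dot-diagram {f = f} d₂
       | c , refl , refl ← dot-diagram {f = f} d₃ | d , refl , refl ← dot-diagram {f = f} d₄
    = _ , occurrence (fromInvolutive f inv) p1234 (λ _ → inverseʳ p1234) ι
        (monotone₄ ι x y (<-≤-trans z i≤k))
        (monotone₄ (f ∘ ι ∘ lookup word1234) u v (<-≤-trans w j≤l))
    where ι = lookup (a ∷ b ∷ c ∷ d ∷ [])

  contains-3214 : ∀ {i j} → Decreasing₃ (diagram f) i j → Below (diagram f) i j →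
                  Contains (fromInvolutive f inv) p3214
  contains-3214 (decreasing₃ x y z u v w d₁ d₂ d₃) (_ , _ , i≤k , j≤l , d₄)
    with a , refl , refl ← dot-diagram {f = f} d₁ | b , refl , refl ← dot-diagram {f = f} d₂
       | c , refl , refl ← dot-diagram {f = f} d₃ | d , refl , refl ← dot-diagram {f = f} d₄
    = _ , occurrence (fromInvolutive f inv) p3214 (λ _ → inverseʳ p3214) ι
        (monotone₄ ι x y (<-≤-trans z i≤k))
        (monotone₄ (f ∘ ι ∘ lookup word3214) u v (<-≤-trans w j≤l))
    where ι = lookup (a ∷ b ∷ c ∷ d ∷ [])

detects-1234 : Detects columnRule p1234
detects-1234 = record
  { avoids⇒grow = λ inv avoids b → increasing-free⇒grow (diagram-involution inv) _ _
      λ inc → avoids (contains-1234 inv inc b)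
  ; grow⇒avoids = λ { {f = f} inv grow (ι , mono , order) →
      let lt = λ a b → Equivalence.from (order a b)
          dot = λ a → diagram-dot {f = f} (ι a)
      -- The dot of the letter 4 puts its own lower left corner into the region, and the other three
      -- letters form a triple in the rectangle under that corner.
      in grow⇒increasing-free (proj₂ (grow (below-dot {f = f} (ι 3F))))
           (increasing₃ (mono {0F} {1F} (s≤s z≤n)) (mono {1F} {2F} (s≤s (s≤s z≤n)))
             (mono {2F} {3F} (s≤s (s≤s (s≤s z≤n))))
             (lt 0F 1F (s≤s z≤n)) (lt 1F 2F (s≤s (s≤s z≤n))) (lt 2F 3F (s≤s (s≤s (s≤s z≤n))))
             (dot 0F) (dot 1F) (dot 2F)) }
  }

detects-3214 : Detects rowRule p3214
detects-3214 = record
  { avoids⇒grow = λ inv avoids b → decreasing-free⇒grow (diagram-involution inv) _ _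
      λ dec → avoids (contains-3214 inv dec b)
  ; grow⇒avoids = λ { {f = f} inv grow (ι , mono , order) →
      let lt = λ a b → Equivalence.from (order a b)
          dot = λ a → diagram-dot {f = f} (ι a)
      in grow⇒decreasing-free (diagram-involution inv) (proj₂ (grow (below-dot {f = f} (ι 3F))))
           (decreasing₃ (mono {0F} {1F} (s≤s z≤n)) (mono {1F} {2F} (s≤s (s≤s z≤n)))
             (mono {2F} {3F} (s≤s (s≤s (s≤s z≤n))))
             (lt 2F 1F (s≤s z≤n)) (lt 1F 0F (s≤s (s≤s z≤n))) (lt 0F 3F (s≤s (s≤s (s≤s z≤n))))
             (dot 0F) (dot 1F) (dot 2F)) }
  }

module _ {n : ℕ} {σ : Permutation′ 4} where

  normalise : ∀ {f : Fin n → Fin n} → IsAvoidingInvolution σ f →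
              Σ (Involutive _≡_ f) λ inv → Avoids (fromInvolutive f inv) σ
  normalise {f} (π , π≗f , π-inv , avoids) = inv , λ (ι , occ) →
    avoids (ι , occurrence-resp (fromInvolutive f inv) π σ (λ i → sym (π≗f i)) (λ _ → refl) occ)
    where
    inv : Involutive _≡_ f
    inv i = trans (sym (trans (cong (π ⟨$⟩ʳ_) (π≗f i)) (π≗f (f i)))) (π-inv i)

  avoiding-resp : ∀ {f g : Fin n → Fin n} → f ≗ g →
                  IsAvoidingInvolution σ f → IsAvoidingInvolution σ g
  avoiding-resp f≗g (π , π≗f , rest) = π , (λ i → trans (π≗f i) (f≗g i)) , rest

transferred : ∀ {R R′ σ σ′} → Detects R σ → Detects R′ σ′ →
  ∀ {n} (f : Fin n → Fin n) → IsAvoidingInvolution σ f →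
  ∃ λ g → IsAvoidingInvolution σ′ g × Involutive _≡_ f × Transfer R R′ (diagram f) (diagram g)
transferred {R} {R′} {σ} {σ′} det det′ {n} f avoiding =
  g , (fromInvolutive g g-inv , (λ _ → refl) , g-inv , g-avoids) , f-inv , t
  where
  f-inv = proj₁ (normalise {σ = σ} avoiding)
  grow : ∀ {i j} → Below (diagram f) i j → ∃ λ α → Grow R (diagram f) i j α
  grow = Detects.avoids⇒grow det f-inv (proj₂ (normalise {σ = σ} avoiding))
  module C = Construct (diagram-involution f-inv) R R′ grow
  g = toInvolution C.involution
  g-inv = toInvolution-involutive C.involution
  t : Transfer R R′ (diagram f) (diagram g)
  t = transfer-respʳ (diagram-toInvolution C.involution) C.transfer
  g-avoids : Avoids (fromInvolutive g g-inv) σ′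
  g-avoids = Detects.grow⇒avoids det′ g-inv λ b → Transfer.grow′ t (Transfer.below′ t b)

-- Comparing the two counts.

module _ {a ℓ} (S : Setoid a ℓ) where
  open Setoid S using (_≈_) renaming (Carrier to A; sym to ≈-sym; trans to ≈-trans)
  open import Data.List.Membership.Setoid S using (_∈_)

  lookup-injective : ∀ {xs} → Unique S xs →
    ∀ i j → List.lookup xs i ≈ List.lookup xs j → i ≡ j
  lookup-injective (_ ∷ _)     0F    0F    _  = refl
  lookup-injective (px ∷ _)    0F    (Fin.suc j) eq =
    contradiction eq (All.lookup px (∈-lookup j))
  lookup-injective (px ∷ _)    (Fin.suc i) 0F    eq =
    contradiction (≈-sym eq) (All.lookup px (∈-lookup i))
  lookup-injective (_ ∷ uniq)  (Fin.suc i) (Fin.suc j) eq = cong Fin.suc (lookup-injective uniq i j eq)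

  -- The injection is a relation `K`: a partner is chosen separately for each list entry, and
  -- injectivity, asked of `K` itself, holds whatever the choice.
  length-filter-≤ : ∀ {p q k} {P : Pred A p} {Q : Pred A q} {K : A → A → Set k}
    (P? : Decidable P) (Q? : Decidable Q) → Q Respects _≈_ →
    ∀ {xs} → Unique S xs → (∀ y → y ∈ xs) →
    (∀ x → P x → ∃ λ y → Q y × K x y) →
    (∀ {x x′ y y′} → K x y → K x′ y′ → y ≈ y′ → x ≈ x′) →
    List.length (List.filter P? xs) ≤ List.length (List.filter Q? xs)
  length-filter-≤ {P = P} {Q} P? Q? resp {xs} uniq complete image K-inj =
    Fin.injective⇒≤ {f = index} inj
    where
    image′ : ∀ i → ∃ λ y → Q y × _
    image′ i = image (List.lookup (List.filter P? xs) i)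
                     (All.lookup (all-filter P? xs) (∈-lookup i))
    member : ∀ i → proj₁ (image′ i) ∈ List.filter Q? xs
    member i = ∈-filter⁺ S Q? resp (complete _) (proj₁ (proj₂ (image′ i)))
    index : Fin (List.length (List.filter P? xs)) → Fin (List.length (List.filter Q? xs))
    index i = Any.index (member i)
    inj : ∀ {i j} → index i ≡ index j → i ≡ j
    inj {i} {j} eq = lookup-injective (Unique.filter⁺ S P? uniq) i j
      (K-inj (proj₂ (proj₂ (image′ i))) (proj₂ (proj₂ (image′ j)))
        (index-injective S (member i) (member j) eq))

funToFin-cong : ∀ {m n} {f g : Fin m → Fin n} → f ≗ g → funToFin f ≡ funToFin g
funToFin-cong {zero}  f≗g = refl
funToFin-cong {suc m} f≗g = cong₂ Fin.combine (f≗g 0F) (funToFin-cong (f≗g ∘ Fin.suc))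

module _ (n : ℕ) where

  private S = Fin n →-setoid Fin n

  selfMaps-unique : Unique S (selfMaps n)
  selfMaps-unique = Unique.map⁺ (setoid _) S
    (λ {c} {d} eq → trans (sym (funToFin-finToFin {n} {n} c))
                          (trans (funToFin-cong eq) (funToFin-finToFin {n} {n} d)))
    (allFin⁺ (n ^ n))

  selfMaps-complete : ∀ f → Any (f ≗_) (selfMaps n)
  selfMaps-complete f = Any.map⁺ (Any.map (λ { refl i → sym (finToFun-funToFin f i) })
                                          (∈-allFin (funToFin f)))

ℐ-≤ : ∀ {R R′ σ σ′} → Detects R σ → Detects R′ σ′ → ∀ n → ℐ n σ ≤ ℐ n σ′
ℐ-≤ {R} {R′} {σ} {σ′} det det′ n = length-filter-≤ (Fin n →-setoid Fin n)
  {K = λ f g → Involutive _≡_ f × Transfer R R′ (diagram f) (diagram g)}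
  (isAvoidingInvolution? σ) (isAvoidingInvolution? σ′) (avoiding-resp {σ = σ′})
  (selfMaps-unique n) (selfMaps-complete n) (transferred det det′)
  -- Partners that agree pointwise have the same matrix, so one transfer can be moved onto the
  -- target of the other.
  λ (inv , t) (_ , t′) g≗g′ → diagram-injective
    (transfer-injective (diagram-involution inv) (transfer-respʳ (diagram-cong g≗g′) t) t′)

corollary6p2 : p1234 ∼ℐ p3214
corollary6p2 n = ≤-antisym (ℐ-≤ detects-1234 detects-3214 n) (ℐ-≤ detects-3214 detects-1234 n)
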